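{- For a set of patterns $\{\rho_1,\rho_2\}$, let $\mathrm{a}_{n,k}^{\mathrm{asc}}(\rho_1,\rho_2)$ (respectively $\mathrm{a}_{n,k}^{\mathrm{des}}(\rho_1,\rho_2)$) denote the number of permutations of $\{1,\dots,n\}$ that avoid both $\rho_1$ and $\rho_2$ and have exactly $k$ ascents (respectively $k$ descents). Then for all integers $n\ge1$ and $k\ge0$, $$\mathrm{a}_{n,k}^{\mathrm{asc}}(132,213)=\mathrm{a}_{n,k}^{\mathrm{des}}(132,213)=\mathrm{a}_{n,k}^{\mathrm{asc}}(213,231)=\mathrm{a}_{n,k}^{\mathrm{des}}(213,231)=\binom{n-1}{k}.$$
   Context: $\mathcal{S}_n$ is the set of permutations $\pi=\pi_1\cdots\pi_n$ of $\{1,\dots,n\}$. For $\rho\in\mathcal{S}_m$, $\pi\in\mathcal{S}_n$ contains $\rho$ if there are indices $1\le i_1<\cdots<i_m\le n$ such that $\pi_{i_a}<\pi_{i_b}$ if and only if $\rho_a<\rho_b$; otherwise $\pi$ avoids $\rho$. The number of ascents is $\mathrm{asc}(\pi)=|\{i:\pi_i<\pi_{i+1}\}|$ and the number of descents is $\mathrm{des}(\pi)=|\{i:\pi_i>\pi_{i+1}\}|$, where $1\le i\le n-1$. -}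

module Defs where

open import Data.Fin.Base using (Fin; zero; suc; inject₁; _<_)
open import Data.Fin.Patterns using (0F; 1F; 2F)
open import Data.Fin.Properties using (_≟_; _<?_; any?; all?)
open import Data.List.Base
  using (List; []; _∷_; [_]; filter; length; allFin; cartesianProductWith)
open import Data.List.Membership.Propositional using (_∈_; lose)
open import Data.List.Membership.Propositional.Properties
  using (∈-allFin; ∈-cartesianProductWith⁺; ∈-filter⁺; ∈-filter⁻)
import Data.List.Relation.Unary.All as All
import Data.List.Relation.Unary.AllPairs as AllPairs
import Data.List.Relation.Unary.Any as Any
open import Data.List.Relation.Unary.Unique.Propositional using (Unique)
import Data.List.Relation.Unary.Unique.Propositional.Properties as Unique
open import Data.Nat.Base using (ℕ; zero; suc)
import Data.Nat.Properties as ℕ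
open import Data.Product.Base using (_×_; _,_; ∃; proj₂)
open import Data.Vec.Base using (Vec; []; _∷_; lookup)
open import Data.Vec.Properties using (∷-injective)
open import Data.Vec.Relation.Unary.Linked using (Linked; linked?)
open import Function.Base using (_∘_)
open import Function.Bundles using (_⇔_; mk⇔; Equivalence)
open import Function.Consequences.Propositional
  using (strictlySurjective⇒surjective; surjective⇒strictlySurjective)
open import Function.Definitions using (Bijective; Injective; Surjective)
open import Relation.Binary.PropositionalEquality using (_≡_; refl)
open import Relation.Nullary.Decidable
  using (Dec; map′; ¬?; _×-dec_; _→-dec_)
open import Relation.Nullary.Negation using (¬_)
open import Relation.Unary using (Decidable)

private
  variable
    m n : ℕ

-- One-line notation π₁⋯πₙ, with positions and values both numbered from 0
-- rather than from 1.

Word : ℕ → Set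
Word n = Vec (Fin n) n

IsPermutation : Word n → Set
IsPermutation π = Bijective _≡_ _≡_ (lookup π)

isPermutation? : Decidable (IsPermutation {n})
isPermutation? π = injective? ×-dec surjective?
  where
  injective? : Dec (Injective _≡_ _≡_ (lookup π))
  injective? = map′ (λ inj {x} {y} → inj x y) (λ inj x y → inj {x} {y})
    (all? λ x → all? λ y → (lookup π x ≟ lookup π y) →-dec (x ≟ y))

  surjective? : Dec (Surjective _≡_ _≡_ (lookup π))
  surjective? = map′
    strictlySurjective⇒surjective
    surjective⇒strictlySurjective
    (all? λ y → any? λ x → lookup π x ≟ y)

vectors : ∀ m n → List (Vec (Fin n) m)
vectors zero    n = [ [] ]
vectors (suc m) n = cartesianProductWith _∷_ (allFin n) (vectors m n)

∈-vectors : (v : Vec (Fin n) m) → v ∈ vectors m n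
∈-vectors []      = Any.here refl
∈-vectors (x ∷ v) = ∈-cartesianProductWith⁺ _∷_ (∈-allFin x) (∈-vectors v)

vectors-unique : ∀ m n → Unique (vectors m n)
vectors-unique zero    n = All.[] AllPairs.∷ AllPairs.[]
vectors-unique (suc m) n =
  Unique.cartesianProductWith⁺ _∷_ ∷-injective
    (Unique.allFin⁺ n) (vectors-unique m n)

permutations : ∀ n → List (Word n)
permutations n = filter isPermutation? (vectors n n)

∈-permutations : {π : Word n} → π ∈ permutations n ⇔ IsPermutation π
∈-permutations {n} {π} = mk⇔
  (λ π∈ → proj₂ (∈-filter⁻ isPermutation? {xs = vectors n n} π∈))
  (∈-filter⁺ isPermutation? (∈-vectors π))

permutations-unique : ∀ n → Unique (permutations n)
permutations-unique n = Unique.filter⁺ isPermutation? (vectors-unique n n)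

-- The vector is lists the positions i₁ < ⋯ < iₘ of the occurrence of ρ in π.

IsOccurrence : Word m → Word n → Vec (Fin n) m → Set
IsOccurrence ρ π is =
  Linked _<_ is ×
  (∀ a b → lookup π (lookup is a) < lookup π (lookup is b)
           ⇔ lookup ρ a < lookup ρ b)

isOccurrence? : (ρ : Word m) (π : Word n) → Decidable (IsOccurrence ρ π)
isOccurrence? ρ π is =
  linked? _<?_ is ×-dec
  (all? λ a → all? λ b →
    (lookup π (lookup is a) <? lookup π (lookup is b))
      ⇔-dec (lookup ρ a <? lookup ρ b))
  where
  _⇔-dec_ : {A B : Set} → Dec A → Dec B → Dec (A ⇔ B)
  a? ⇔-dec b? = map′
    (λ (f , g) → mk⇔ f g)
    (λ e → Equivalence.to e , Equivalence.from e)
    ((a? →-dec b?) ×-dec (b? →-dec a?))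

_Contains_ : Word n → Word m → Set
π Contains ρ = ∃ (IsOccurrence ρ π)

_contains?_ : (π : Word n) (ρ : Word m) → Dec (π Contains ρ)
_contains?_ {n} {m} π ρ = map′
  Any.satisfied
  (λ (is , p) → lose (∈-vectors is) p)
  (Any.any? (isOccurrence? ρ π) (vectors m n))

_Avoids_ : Word n → Word m → Set
π Avoids ρ = ¬ (π Contains ρ)

_avoids?_ : (π : Word n) (ρ : Word m) → Dec (π Avoids ρ)
π avoids? ρ = ¬? (π contains? ρ)

asc : Word n → ℕ
asc {zero}  π = 0
asc {suc n} π =
  length (filter (λ i → lookup π (inject₁ i) <? lookup π (suc i)) (allFin n))

des : Word n → ℕ
des {zero}  π = 0
des {suc n} π =
  length (filter (λ i → lookup π (suc i) <? lookup π (inject₁ i)) (allFin n))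

-- The number of π ∈ Sₙ avoiding ρ₁ and ρ₂ with st π = k.

avoiders : ∀ {m₁ m₂} (st : ∀ {n} → Word n → ℕ) (n k : ℕ) →
           Word m₁ → Word m₂ → ℕ
avoiders st n k ρ₁ ρ₂ = length
  (filter (λ π → (π avoids? ρ₁) ×-dec (π avoids? ρ₂) ×-dec (st π ℕ.≟ k))
          (permutations n))

aᵃˢᶜ aᵈᵉˢ : ∀ {m₁ m₂} (n k : ℕ) → Word m₁ → Word m₂ → ℕ
aᵃˢᶜ = avoiders asc
aᵈᵉˢ = avoiders des

p132 p213 p231 : Word 3
p132 = 0F ∷ 2F ∷ 1F ∷ []
p213 = 1F ∷ 0F ∷ 2F ∷ []
p231 = 1F ∷ 2F ∷ 0F ∷ []

{-# OPTIONS --safe #-}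

-- Deleting the first letter a of an avoider of size n + 2 and standardizing
-- leaves an avoider σ of size n + 1. Conversely, σ extends by exactly two first
-- letters: the maximum, which creates a descent, and a smaller one, which
-- creates an ascent. The smaller one is the minimum for {213, 231}, and the
-- value just below the first letter of σ for {132, 213}. So both statistics
-- satisfy Pascal's recurrence.

module Submission where

open import Data.Empty using (⊥)
open import Data.Fin.Base using (Fin; zero; suc; toℕ; fromℕ; inject₁; punchIn; punchOut; _<_; _≤_)
open import Data.Fin.Patterns using (0F; 1F; 2F)
open import Data.Fin.Properties
  using (_≟_; _<?_; <-cmp; <-irrefl; <-asym; ≤∧≢⇒<; ≤fromℕ; fromℕ≢inject₁; toℕ-inject₁;
         punchIn-injective; punchInᵢ≢i; punchIn-mono-≤; punchIn-punchOut; suc-injective)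
open import Data.Fin.Relation.Unary.Top using (view; ‵fromℕ; ‵inject₁)
open import Data.List.Base as List using (List; []; _∷_; _++_; filter; length; allFin)
open import Data.List.Membership.Propositional using (_∈_)
open import Data.List.Membership.Propositional.Properties
  using (∈-map⁺; ∈-map⁻; ∈-++⁺ˡ; ∈-++⁺ʳ; ∈-++⁻; ∈-filter⁺; ∈-filter⁻)
open import Data.List.Membership.Propositional.Properties.WithK using (unique∧set⇒bag)
open import Data.List.Properties using (filter-accept; filter-reject; length-map; length-++)
open import Data.List.Relation.Binary.BagAndSetEquality using (∼bag⇒↭)
open import Data.List.Relation.Binary.Permutation.Propositional.Properties using (↭-length)
open import Data.List.Relation.Unary.All using ([])
open import Data.List.Relation.Unary.AllPairs using ([]; _∷_)
open import Data.List.Relation.Unary.Any using (here)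
open import Data.List.Relation.Unary.Unique.Propositional using (Unique)
import Data.List.Relation.Unary.Unique.Propositional.Properties as Unique
open import Data.Nat.Base using (ℕ; zero; suc; _∸_; _≥_; _+_; z≤n; s≤s)
open import Data.Nat.Combinatorics using (_C_; nCk+nC[k+1]≡[n+1]C[k+1])
import Data.Nat.Base as ℕ
import Data.Nat.Properties as ℕ
open import Data.Product.Base using (_×_; _,_; ∃; proj₂)
open import Data.Sum.Base as Sum using (_⊎_; inj₁; inj₂)
open import Data.Vec.Base using (Vec; []; _∷_; lookup; map; head; tabulate)
open import Data.Vec.Properties
  using (∷-injectiveˡ; ∷-injectiveʳ; lookup-map; map-∘; map-cong;
         tabulate-∘; tabulate-cong; tabulate∘lookup)
open import Data.Vec.Relation.Unary.Linked using (Linked; []; [-]; _∷_)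
import Data.Vec.Relation.Unary.Linked as Linked
import Data.Vec.Relation.Unary.Linked.Properties as Linked
open import Function.Base using (_∘_; id)
open import Function.Bundles using (_⇔_; mk⇔; Equivalence)
open import Function.Consequences.Propositional
  using (strictlySurjective⇒surjective; surjective⇒strictlySurjective)
open import Function.Definitions using (StrictlySurjective)
open import Level using (0ℓ)
open import Relation.Binary.Core using (Rel)
open import Relation.Binary.Definitions using (tri<; tri≈; tri>)
import Relation.Binary.Definitions as Binary
open import Relation.Binary.PropositionalEquality
  using (_≡_; _≢_; refl; sym; trans; cong; cong₂; subst; subst₂; module ≡-Reasoning)
open import Relation.Nullary.Decidable using (_×-dec_; yes; no)
open import Relation.Nullary.Negation using (¬_; contradiction)
open import Relation.Unary using (Decidable)
open import Defs

private
  variable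
    m n : ℕ

open Equivalence using (to; from)

-- Order properties of `punchIn`

increasing⇒reflects-< : {f : Fin m → Fin n} → (∀ {i j} → i < j → f i < f j) →
                        ∀ {i j} → f i < f j → i < j
increasing⇒reflects-< {f = f} f-inc {i} {j} fi<fj with <-cmp i j
... | tri< i<j _ _  = i<j
... | tri≈ _ refl _ = contradiction fi<fj (<-irrefl refl)
... | tri> _ _ j<i  = contradiction fi<fj (<-asym (f-inc j<i))

punchIn-mono-< : ∀ (a : Fin (suc n)) {i j} → i < j → punchIn a i < punchIn a j
punchIn-mono-< a {i} {j} i<j = ≤∧≢⇒< (punchIn-mono-≤ a i j (ℕ.<⇒≤ i<j))
  λ eq → <-irrefl (punchIn-injective a i j eq) i<j

punchIn-cancel-< : ∀ (a : Fin (suc n)) {i j} → punchIn a i < punchIn a j → i < j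
punchIn-cancel-< a = increasing⇒reflects-< (punchIn-mono-< a)

-- `punchIn a` raises the values from `a` on by one and fixes those below. This lemma and the next
-- three translate between comparing `a` with a later letter of `a ◂ σ` and comparing it with a
-- letter of `σ`.
≤⇒<punchIn : ∀ (a : Fin (suc n)) i → a ≤ i → a < punchIn a i
≤⇒<punchIn zero    i       _         = s≤s z≤n
≤⇒<punchIn (suc a) (suc i) (s≤s a≤i) = s≤s (≤⇒<punchIn a i a≤i)

<⇒punchIn< : ∀ (a : Fin (suc n)) i → i < a → punchIn a i < a
<⇒punchIn< (suc a) zero    _         = s≤s z≤n
<⇒punchIn< (suc a) (suc i) (s≤s i<a) = s≤s (<⇒punchIn< a i i<a)

<punchIn⇒≤ : ∀ (a : Fin (suc n)) i → a < punchIn a i → a ≤ i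
<punchIn⇒≤ a i a<↑i = ℕ.≮⇒≥ λ i<a → ℕ.<-asym a<↑i (<⇒punchIn< a i i<a)

punchIn<⇒< : ∀ (a : Fin (suc n)) i → punchIn a i < a → i < a
punchIn<⇒< a i ↑i<a = ℕ.≰⇒> λ a≤i → ℕ.<-asym ↑i<a (≤⇒<punchIn a i a≤i)

occurs : ∀ (π : Word n) → IsPermutation π → StrictlySurjective _≡_ (lookup π)
occurs _ (_ , surj) = surjective⇒strictlySurjective surj

-- Splitting a permutation into its first letter and a standardized rest

infixr 5 _◂_

-- Every permutation of size n + 1 is a ◂ σ for a unique first letter a and a
-- unique permutation σ of size n, the standardization of the other letters.

_◂_ : Fin (suc n) → Word n → Word (suc n)
a ◂ σ = a ∷ map (punchIn a) σ

map-injective : ∀ {A B : Set} {f : A → B} → (∀ {x y} → f x ≡ f y → x ≡ y) →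
                (u v : Vec A m) → map f u ≡ map f v → u ≡ v
map-injective f-inj []      []      _  = refl
map-injective f-inj (x ∷ u) (y ∷ v) eq =
  cong₂ _∷_ (f-inj (∷-injectiveˡ eq)) (map-injective f-inj u v (∷-injectiveʳ eq))

◂-injective : ∀ {a b : Fin (suc n)} {σ τ} → a ◂ σ ≡ b ◂ τ → a ≡ b × σ ≡ τ
◂-injective {a = a} {σ = σ} {τ} eq with ∷-injectiveˡ eq
... | refl = refl , map-injective (λ {x} {y} → punchIn-injective a x y) σ τ (∷-injectiveʳ eq)

-- Injectivity keeps `a` out of the remaining letters, so `punchOut` can close the gap that `a`
-- leaves among them.
◂-surjective : (π : Word (suc n)) → IsPermutation π → ∃ λ a → ∃ λ σ → π ≡ a ◂ σ
◂-surjective {n} (a ∷ τ) (inj , _) = a , tabulate standardized , cong (a ∷_) (begin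
  τ                                     ≡⟨ tabulate∘lookup τ ⟨
  tabulate (lookup τ)                   ≡⟨ tabulate-cong (λ i → punchIn-punchOut (a≢ i)) ⟨
  tabulate (punchIn a ∘ standardized)   ≡⟨ tabulate-∘ (punchIn a) standardized ⟩
  map (punchIn a) (tabulate standardized) ∎)
  where
  open ≡-Reasoning
  a≢ : ∀ i → a ≢ lookup τ i
  a≢ i eq with () ← inj {zero} {suc i} eq

  standardized : Fin n → Fin n
  standardized i = punchOut (a≢ i)

◂-permutation⁺ : ∀ (a : Fin (suc n)) σ → IsPermutation σ → IsPermutation (a ◂ σ)
◂-permutation⁺ a σ perm@(inj , _) =
  (λ {i} {j} → inj′ i j) , strictlySurjective⇒surjective surj′
  where
  inj′ : ∀ i j → lookup (a ◂ σ) i ≡ lookup (a ◂ σ) j → i ≡ j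
  inj′ zero    zero    _  = refl
  inj′ zero    (suc j) eq =
    contradiction (trans (sym (lookup-map j _ σ)) (sym eq)) (punchInᵢ≢i a _)
  inj′ (suc i) zero    eq =
    contradiction (trans (sym (lookup-map i _ σ)) eq) (punchInᵢ≢i a _)
  inj′ (suc i) (suc j) eq = cong suc (inj (punchIn-injective a _ _
    (trans (sym (lookup-map i _ σ)) (trans eq (lookup-map j _ σ)))))

  surj′ : StrictlySurjective _≡_ (lookup (a ◂ σ))
  surj′ y with y ≟ a
  ... | yes y≡a = zero , sym y≡a
  ... | no  y≢a with occurs σ perm (punchOut (y≢a ∘ sym))
  ...   | i , eq = suc i , trans (lookup-map i _ σ)
                             (trans (cong (punchIn a) eq) (punchIn-punchOut (y≢a ∘ sym)))

◂-permutation⁻ : ∀ (a : Fin (suc n)) σ → IsPermutation (a ◂ σ) → IsPermutation σ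
◂-permutation⁻ a σ perm@(inj , _) =
  (λ {i} {j} eq → suc-injective (inj (trans (lookup-map i _ σ)
                    (trans (cong (punchIn a) eq) (sym (lookup-map j _ σ)))))) ,
  strictlySurjective⇒surjective surj′
  where
  surj′ : StrictlySurjective _≡_ (lookup σ)
  surj′ y with occurs (a ◂ σ) perm (punchIn a y)
  ... | zero  , eq = contradiction (sym eq) (punchInᵢ≢i a y)
  ... | suc i , eq = i , punchIn-injective a _ _ (trans (sym (lookup-map i _ σ)) eq)

-- Pattern occurrences under prepending a letter

SameOrder : Vec (Fin n) m → Word m → Set
SameOrder v ρ = ∀ p q → lookup v p < lookup v q ⇔ lookup ρ p < lookup ρ q

-- `SameOrder` speaks of the letters of an occurrence instead of their positions, so that it can be
-- transported along equations between vectors of letters.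
contains⁺ : ∀ (π : Word n) (ρ : Word m) is → Linked _<_ is →
            SameOrder (map (lookup π) is) ρ → π Contains ρ
contains⁺ π ρ is is↑ same = is , is↑ , λ p q →
  subst₂ (λ x y → x < y ⇔ lookup ρ p < lookup ρ q)
    (lookup-map p _ is) (lookup-map q _ is) (same p q)

contains⁻ : ∀ (π : Word n) (ρ : Word m) → π Contains ρ →
            ∃ λ is → Linked _<_ is × SameOrder (map (lookup π) is) ρ
contains⁻ π ρ (is , is↑ , same) = is , is↑ , λ p q →
  subst₂ (λ x y → x < y ⇔ lookup ρ p < lookup ρ q)
    (sym (lookup-map p _ is)) (sym (lookup-map q _ is)) (same p q)

-- `punchIn a` is strictly increasing, so it preserves and reflects `<`: standardization neither
-- creates nor destroys occurrences.
sameOrder-punchIn : ∀ (a : Fin (suc n)) (v : Vec (Fin n) m) ρ →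
                    SameOrder (map (punchIn a) v) ρ ⇔ SameOrder v ρ
sameOrder-punchIn a v ρ = mk⇔
  (λ same p q → mk⇔
    (to (same p q) ∘ from (lookup-< p q))
    (to (lookup-< p q) ∘ from (same p q)))
  (λ same p q → mk⇔
    (to (same p q) ∘ to (lookup-< p q))
    (from (lookup-< p q) ∘ from (same p q)))
  where
  lookup-< : ∀ p q → lookup (map (punchIn a) v) p < lookup (map (punchIn a) v) q ⇔
                     lookup v p < lookup v q
  lookup-< p q rewrite lookup-map p (punchIn a) v | lookup-map q (punchIn a) v =
    mk⇔ (punchIn-cancel-< a) (punchIn-mono-< a)

lookup-◂-suc : ∀ (a : Fin (suc n)) σ (is : Vec (Fin n) m) →
               map (lookup (a ◂ σ)) (map suc is) ≡ map (punchIn a) (map (lookup σ) is)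
lookup-◂-suc a σ is = begin
  map (lookup (a ◂ σ)) (map suc is)    ≡⟨ map-∘ _ _ is ⟨
  map (lookup (map (punchIn a) σ)) is  ≡⟨ map-cong (λ i → lookup-map i _ σ) is ⟩
  map (punchIn a ∘ lookup σ) is        ≡⟨ map-∘ _ _ is ⟩
  map (punchIn a) (map (lookup σ) is)  ∎
  where open ≡-Reasoning

◂-avoids⁻ : ∀ (a : Fin (suc n)) σ (ρ : Word m) → (a ◂ σ) Avoids ρ → σ Avoids ρ
◂-avoids⁻ a σ ρ avoids occ with contains⁻ σ ρ occ
... | is , is↑ , same = avoids (contains⁺ (a ◂ σ) ρ (map suc is)
  (Linked.map⁺ (Linked.map s≤s is↑))
  (subst (λ v → SameOrder v ρ) (sym (lookup-◂-suc a σ is))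
    (from (sameOrder-punchIn a (map (lookup σ) is) ρ) same)))

◂-letters : Fin (suc n) → Word n → Fin n → Fin n → Vec (Fin (suc n)) 3
◂-letters a σ j k = a ∷ punchIn a (lookup σ j) ∷ punchIn a (lookup σ k) ∷ []

◂-contains⁺ : ∀ (a : Fin (suc n)) σ (ρ : Word 3) {j k} → j < k →
              SameOrder (◂-letters a σ j k) ρ → (a ◂ σ) Contains ρ
◂-contains⁺ a σ ρ {j} {k} j<k same =
  contains⁺ (a ◂ σ) ρ (zero ∷ suc j ∷ suc k ∷ []) (s≤s z≤n ∷ s≤s j<k ∷ [-])
    (subst (λ v → SameOrder (a ∷ v) ρ) (sym (lookup-◂-suc a σ (j ∷ k ∷ []))) same)

-- Positions in an occurrence increase, so it either starts at the first letter or lies entirely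
-- among the later ones; in the second case it is an occurrence in `σ`.
◂-avoids⁺ : ∀ (a : Fin (suc n)) σ (ρ : Word 3) → σ Avoids ρ →
            (∀ j k → j < k → ¬ SameOrder (◂-letters a σ j k) ρ) → (a ◂ σ) Avoids ρ
◂-avoids⁺ a σ ρ avoids none occ with contains⁻ (a ◂ σ) ρ occ
... | zero ∷ suc j ∷ suc k ∷ [] , _ ∷ s≤s j<k ∷ [-] , same =
  none j k j<k (subst (λ v → SameOrder (a ∷ v) ρ) (lookup-◂-suc a σ (j ∷ k ∷ [])) same)
... | suc i ∷ suc j ∷ suc k ∷ [] , s≤s i<j ∷ s≤s j<k ∷ [-] , same =
  avoids (contains⁺ σ ρ (i ∷ j ∷ k ∷ []) (i<j ∷ j<k ∷ [-])
    (to (sameOrder-punchIn a (map (lookup σ) (i ∷ j ∷ k ∷ [])) ρ)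
      (subst (λ v → SameOrder v ρ) (lookup-◂-suc a σ (i ∷ j ∷ k ∷ [])) same)))

singleton-avoids : (ρ : Word 3) → (0F ∷ []) Avoids ρ
singleton-avoids ρ (0F ∷ 0F ∷ _ , () ∷ _ , _)

singleton-permutation : IsPermutation (0F ∷ [])
singleton-permutation = (λ { {0F} {0F} _ → refl }) ,
  strictlySurjective⇒surjective λ { 0F → 0F , refl }

-- The letters are given in increasing order and `ρ` arranges them into its own shape; for `p213`
-- the vector reduces to `y ∷ x ∷ z ∷ []`. Two inequalities thus replace a check of all nine pairs.
sameOrder-sorted : ∀ {x y z : Fin n} → x < y → y < z → (ρ : Word 3) →
                   SameOrder (map (lookup (x ∷ y ∷ z ∷ [])) ρ) ρ
sameOrder-sorted {x = x} {y} {z} x<y y<z ρ p q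
  rewrite lookup-map p (lookup (x ∷ y ∷ z ∷ [])) ρ
        | lookup-map q (lookup (x ∷ y ∷ z ∷ [])) ρ
  = mk⇔ (increasing⇒reflects-< (λ {i} {j} → inc i j)) (inc _ _)
  where
  inc : ∀ i j → i < j → lookup (x ∷ y ∷ z ∷ []) i < lookup (x ∷ y ∷ z ∷ []) j
  inc 0F 1F _ = x<y
  inc 0F 2F _ = ℕ.<-trans x<y y<z
  inc 1F 2F _ = y<z
  inc 0F 0F ()
  inc 1F 0F ()
  inc 1F 1F (s≤s ())
  inc 2F 0F ()
  inc 2F 1F (s≤s ())
  inc 2F 2F (s≤s (s≤s ()))

-- Avoiders and their two extensions

record Avoider (ρ₁ ρ₂ : Word 3) (π : Word n) : Set where
  constructor avoider
  field
    permutation : IsPermutation π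
    avoids₁     : π Avoids ρ₁
    avoids₂     : π Avoids ρ₂

◂-avoider⁻ : ∀ {ρ₁ ρ₂} {a : Fin (suc n)} {σ} → Avoider ρ₁ ρ₂ (a ◂ σ) → Avoider ρ₁ ρ₂ σ
◂-avoider⁻ {ρ₁ = ρ₁} {ρ₂} {a} {σ} (avoider p av₁ av₂) =
  avoider (◂-permutation⁻ a σ p) (◂-avoids⁻ a σ ρ₁ av₁) (◂-avoids⁻ a σ ρ₂ av₂)

FirstLetter : Set
FirstLetter = ∀ {n} → Word (suc n) → Fin (suc (suc n))

-- A generating tree in which every avoider of positive size has exactly two children.
record Generates (ρ₁ ρ₂ : Word 3) (h₁ h₂ : FirstLetter) : Set where
  field
    distinct : ∀ {n} (σ : Word (suc n)) → h₁ σ ≢ h₂ σ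
    sound₁   : ∀ {n} {σ : Word (suc n)} → Avoider ρ₁ ρ₂ σ → Avoider ρ₁ ρ₂ (h₁ σ ◂ σ)
    sound₂   : ∀ {n} {σ : Word (suc n)} → Avoider ρ₁ ρ₂ σ → Avoider ρ₁ ρ₂ (h₂ σ ◂ σ)
    complete : ∀ {n} a {σ : Word (suc n)} → Avoider ρ₁ ρ₂ (a ◂ σ) → a ≡ h₁ σ ⊎ a ≡ h₂ σ

-- The counting below takes the rule that raises the statistic first. Ascents and descents are
-- raised by opposite rules, so one tree is used in both orders.
generates-swap : ∀ {ρ₁ ρ₂} {h₁ h₂ : FirstLetter} →
                 Generates ρ₁ ρ₂ h₁ h₂ → Generates ρ₁ ρ₂ h₂ h₁
generates-swap g = record
  { distinct = λ σ → distinct σ ∘ sym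
  ; sound₁   = sound₂
  ; sound₂   = sound₁
  ; complete = λ a → Sum.swap ∘ complete a
  }
  where open Generates g

-- Counting by Pascal's recurrence

module Counting
  {ρ₁ ρ₂ : Word 3} {h⁺ h⁻ : FirstLetter} (generates : Generates ρ₁ ρ₂ h⁺ h⁻)
  (st : ∀ {n} → Word n → ℕ)
  (st-singleton : st (0F ∷ []) ≡ 0)
  (st-raised : ∀ {n} (σ : Word (suc n)) → st (h⁺ σ ◂ σ) ≡ suc (st σ))
  (st-kept   : ∀ {n} (σ : Word (suc n)) → st (h⁻ σ ◂ σ) ≡ st σ)
  where
  open Generates generates

  raise keep : Word (suc n) → Word (suc (suc n))
  raise σ = h⁺ σ ◂ σ
  keep  σ = h⁻ σ ◂ σ

  -- Row `n` of Pascal's triangle, with lists of avoiders of size `suc n` as entries and the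
  -- statistic as column. Column `zero` has no raised words, since raising makes the statistic
  -- positive.
  words : ∀ n → ℕ → List (Word (suc n))
  words zero    zero    = (0F ∷ []) ∷ []
  words zero    (suc k) = []
  words (suc n) zero    = List.map keep (words n zero)
  words (suc n) (suc k) = List.map raise (words n k) ++ List.map keep (words n (suc k))

  length-words : ∀ n k → length (words n k) ≡ n C k
  length-words zero    zero    = refl
  length-words zero    (suc k) = refl
  length-words (suc n) zero    = trans (length-map keep (words n zero)) (length-words n zero)
  length-words (suc n) (suc k) = begin
    length (List.map raise (words n k) ++ List.map keep (words n (suc k)))
      ≡⟨ length-++ (List.map raise (words n k)) ⟩
    length (List.map raise (words n k)) + length (List.map keep (words n (suc k)))
      ≡⟨ cong₂ _+_ (length-map raise (words n k)) (length-map keep (words n (suc k))) ⟩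
    length (words n k) + length (words n (suc k))
      ≡⟨ cong₂ _+_ (length-words n k) (length-words n (suc k)) ⟩
    n C k + n C suc k
      ≡⟨ nCk+nC[k+1]≡[n+1]C[k+1] n k ⟩
    suc n C suc k ∎
    where open ≡-Reasoning

  -- Extension is injective by `◂-injective`, and a word both raised and kept would come from a
  -- single `σ` on which the two rules agree.
  words-unique : ∀ n k → Unique (words n k)
  words-unique zero    zero    = [] ∷ []
  words-unique zero    (suc k) = []
  words-unique (suc n) zero    = Unique.map⁺ (proj₂ ∘ ◂-injective) (words-unique n zero)
  words-unique (suc n) (suc k) = Unique.++⁺
    (Unique.map⁺ (proj₂ ∘ ◂-injective) (words-unique n k))
    (Unique.map⁺ (proj₂ ∘ ◂-injective) (words-unique n (suc k)))
    disjoint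
    where
    disjoint : ∀ {π} → ¬ (π ∈ List.map raise (words n k) × π ∈ List.map keep (words n (suc k)))
    disjoint (π∈₁ , π∈₂) with ∈-map⁻ raise π∈₁ | ∈-map⁻ keep π∈₂
    ... | σ , _ , refl | τ , _ , eq with ◂-injective eq
    ...   | h⁺σ≡h⁻τ , refl = distinct σ h⁺σ≡h⁻τ

  words-sound : ∀ n k {π} → π ∈ words n k → Avoider ρ₁ ρ₂ π × st π ≡ k
  words-sound zero    zero    (here refl) =
    avoider singleton-permutation (singleton-avoids ρ₁) (singleton-avoids ρ₂) , st-singleton
  words-sound (suc n) zero    π∈ with ∈-map⁻ keep π∈
  ... | σ , σ∈ , refl with words-sound n zero σ∈
  ...   | av , eq = sound₂ av , trans (st-kept σ) eq
  words-sound (suc n) (suc k) π∈ with ∈-++⁻ (List.map raise (words n k)) π∈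
  ... | inj₁ π∈₁ with ∈-map⁻ raise π∈₁
  ...   | σ , σ∈ , refl with words-sound n k σ∈
  ...     | av , eq = sound₁ av , trans (st-raised σ) (cong suc eq)
  words-sound (suc n) (suc k) π∈ | inj₂ π∈₂ with ∈-map⁻ keep π∈₂
  ...   | σ , σ∈ , refl with words-sound n (suc k) σ∈
  ...     | av , eq = sound₂ av , trans (st-kept σ) eq

  raise-∈ : ∀ {n} k {σ : Word (suc n)} → σ ∈ words n k → raise σ ∈ words (suc n) (suc k)
  raise-∈ k σ∈ = ∈-++⁺ˡ (∈-map⁺ raise σ∈)

  keep-∈ : ∀ {n} k {σ : Word (suc n)} → σ ∈ words n k → keep σ ∈ words (suc n) k
  keep-∈ zero    σ∈ = ∈-map⁺ keep σ∈
  keep-∈ (suc k) σ∈ = ∈-++⁺ʳ _ (∈-map⁺ keep σ∈)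

  -- Induction on the size by deleting the first letter; `complete` tells which rule supplied it,
  -- and hence how the column changes.
  words-complete : ∀ {n} {π : Word (suc n)} → Avoider ρ₁ ρ₂ π → π ∈ words n (st π)
  words-complete {zero} {0F ∷ []} _ =
    subst (λ k → (0F ∷ []) ∈ words zero k) (sym st-singleton) (here refl)
  words-complete {suc n} {π} av with ◂-surjective π (Avoider.permutation av)
  ... | a , σ , refl with complete a av
  ...   | inj₁ refl = subst (λ k → raise σ ∈ words (suc n) k) (sym (st-raised σ))
                        (raise-∈ (st σ) (words-complete (◂-avoider⁻ av)))
  ...   | inj₂ refl = subst (λ k → keep σ ∈ words (suc n) k) (sym (st-kept σ))
                        (keep-∈ (st σ) (words-complete (◂-avoider⁻ av)))

  -- Two duplicate-free lists with the same members are rearrangements of each other, so they have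
  -- equal length.
  avoiders≡C : ∀ n k → avoiders st (suc n) k ρ₁ ρ₂ ≡ n C k
  avoiders≡C n k = trans
    (↭-length (∼bag⇒↭ (unique∧set⇒bag
      (Unique.filter⁺ P? (permutations-unique (suc n))) (words-unique n k)
      (mk⇔ to-words from-words))))
    (length-words n k)
    where
    P? : Decidable (λ (π : Word (suc n)) → π Avoids ρ₁ × π Avoids ρ₂ × st π ≡ k)
    P? π = (π avoids? ρ₁) ×-dec (π avoids? ρ₂) ×-dec (st π ℕ.≟ k)

    to-words : ∀ {π} → π ∈ filter P? (permutations (suc n)) → π ∈ words n k
    to-words π∈ with ∈-filter⁻ P? π∈
    ... | π∈perms , av₁ , av₂ , refl = words-complete (avoider (to ∈-permutations π∈perms) av₁ av₂)

    from-words : ∀ {π} → π ∈ words n k → π ∈ filter P? (permutations (suc n))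
    from-words π∈ with words-sound n k π∈
    ... | avoider p av₁ av₂ , eq = ∈-filter⁺ P? (from ∈-permutations p) (av₁ , av₂ , eq)

-- Ascents and descents as counts of adjacent pairs

length-filter-tabulate :
  ∀ {A B : Set} {P : A → Set} {Q : B → Set} (P? : Decidable P) (Q? : Decidable Q)
  (f : Fin n → A) (g : Fin n → B) → (∀ i → P (f i) ⇔ Q (g i)) →
  length (filter P? (List.tabulate f)) ≡ length (filter Q? (List.tabulate g))
length-filter-tabulate {zero}  P? Q? f g P⇔Q = refl
length-filter-tabulate {suc n} P? Q? f g P⇔Q
  with P? (f zero) | Q? (g zero) | length-filter-tabulate P? Q? (f ∘ suc) (g ∘ suc) (P⇔Q ∘ suc)
... | yes _ | yes _ | ih = cong suc ih
... | yes p | no ¬q | _  = contradiction (to (P⇔Q zero) p) ¬q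
... | no ¬p | yes q | _  = contradiction (from (P⇔Q zero) q) ¬p
... | no _  | no _  | ih = ih

-- `count` unfolds to `asc` when `R` is `<` and to `des` when `R` is its converse. Invariance of `R`
-- under `punchIn` makes standardization harmless to the count.
module AdjacentPairs
  {R : ∀ {n} → Rel (Fin n) 0ℓ} (R? : ∀ {n} → Binary.Decidable (R {n}))
  (R-punchIn : ∀ {n} (a : Fin (suc n)) {i j} → R (punchIn a i) (punchIn a j) ⇔ R i j)
  where

  At : (π : Word (suc n)) → Fin n → Set
  At π i = R (lookup π (inject₁ i)) (lookup π (suc i))

  At? : (π : Word (suc n)) → Decidable (At π)
  At? π i = R? (lookup π (inject₁ i)) (lookup π (suc i))

  count : Word (suc n) → ℕ
  count π = length (filter (At? π) (allFin _))

  count-tail : ∀ a (σ : Word (suc n)) →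
               length (filter (At? (a ◂ σ)) (List.tabulate suc)) ≡ count σ
  count-tail a σ = length-filter-tabulate (At? (a ◂ σ)) (At? σ) suc id at⇔
    where
    at⇔ : ∀ i → At (a ◂ σ) (suc i) ⇔ At σ i
    at⇔ i rewrite lookup-map (inject₁ i) (punchIn a) σ | lookup-map (suc i) (punchIn a) σ =
      R-punchIn a

  count-raised : ∀ a (σ : Word (suc n)) → R a (punchIn a (head σ)) → count (a ◂ σ) ≡ suc (count σ)
  -- Splitting `σ` lets the pair at position `0F` reduce to `a` and `punchIn a (head σ)`; it is the
  -- only pair that prepending adds.
  count-raised a σ@(_ ∷ _) r = trans
    (cong length (filter-accept (At? (a ◂ σ)) {0F} {List.tabulate suc} r))
    (cong suc (count-tail a σ))

  count-kept : ∀ a (σ : Word (suc n)) → ¬ R a (punchIn a (head σ)) → count (a ◂ σ) ≡ count σ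
  count-kept a σ@(_ ∷ _) ¬r = trans
    (cong length (filter-reject (At? (a ◂ σ)) {0F} {List.tabulate suc} ¬r))
    (count-tail a σ)

module Ascents = AdjacentPairs {R = _<_} _<?_
  (λ a → mk⇔ (punchIn-cancel-< a) (punchIn-mono-< a))
module Descents = AdjacentPairs {R = λ i j → j < i} (λ i j → j <? i)
  (λ a → mk⇔ (punchIn-cancel-< a) (punchIn-mono-< a))

-- Low and maximal first letters

max : FirstLetter
max _ = fromℕ _

fromℕ≮ : (i : Fin (suc n)) → ¬ fromℕ n < i
fromℕ≮ i max<i = ℕ.<⇒≱ max<i (≤fromℕ i)

punchIn-max< : (i : Fin n) → punchIn (fromℕ n) i < fromℕ n
punchIn-max< i = ≤∧≢⇒< (≤fromℕ _) (punchInᵢ≢i _ i)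

module Statistics
  {ρ₁ ρ₂ : Word 3} {low : FirstLetter} (low≤head : ∀ {n} (σ : Word (suc n)) → low σ ≤ head σ)
  (generates : Generates ρ₁ ρ₂ low max)
  where

  -- Making room for the new letter shifts the old head up, so the comparison is strict even if the
  -- two values were equal, as they are for `inject₁ ∘ head`.
  low< : (σ : Word (suc n)) → low σ < punchIn (low σ) (head σ)
  low< σ = ≤⇒<punchIn (low σ) (head σ) (low≤head σ)

  aᵃˢᶜ≡C : ∀ n k → aᵃˢᶜ (suc n) k ρ₁ ρ₂ ≡ n C k
  aᵃˢᶜ≡C = Counting.avoiders≡C generates asc refl
    (λ σ → Ascents.count-raised (low σ) σ (low< σ))
    (λ σ → Ascents.count-kept (max σ) σ (fromℕ≮ _))

  aᵈᵉˢ≡C : ∀ n k → aᵈᵉˢ (suc n) k ρ₁ ρ₂ ≡ n C k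
  aᵈᵉˢ≡C = Counting.avoiders≡C (generates-swap generates) des refl
    (λ σ → Descents.count-raised (max σ) σ (punchIn-max< (head σ)))
    (λ σ → Descents.count-kept (low σ) σ (<-asym (low< σ)))

-- In an occurrence starting at the new letter, the letter matching position `q` of `ρ` would exceed
-- the maximum.
max-avoids : ∀ (ρ : Word 3) q → lookup ρ 0F < lookup ρ q →
             ∀ (σ : Word n) → σ Avoids ρ → (fromℕ n ◂ σ) Avoids ρ
max-avoids {n} ρ q ρ₀<ρq σ av = ◂-avoids⁺ (fromℕ n) σ ρ av
  λ j k _ same → fromℕ≮ _ (from (same 0F q) ρ₀<ρq)

-- Dually, the letter matching position `q` would lie below the minimum.
zero-avoids : ∀ (ρ : Word 3) q → lookup ρ q < lookup ρ 0F →
              ∀ (σ : Word n) → σ Avoids ρ → (0F ◂ σ) Avoids ρ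
zero-avoids ρ q ρq<ρ₀ σ av = ◂-avoids⁺ 0F σ ρ av
  λ j k _ same → ℕ.n≮0 (from (same q 0F) ρq<ρ₀)

-- First letters for {213, 231}

zero-or-max : Generates p213 p231 (λ _ → 0F) max
zero-or-max = record
  { distinct = λ _ ()
  ; sound₁   = λ { {σ = σ} (avoider p av₁ av₂) → avoider (◂-permutation⁺ 0F σ p)
      (zero-avoids p213 1F (s≤s z≤n) σ av₁) (zero-avoids p231 2F (s≤s z≤n) σ av₂) }
  ; sound₂   = λ { {σ = σ} (avoider p av₁ av₂) → avoider (◂-permutation⁺ _ σ p)
      (max-avoids p213 2F (s≤s (s≤s z≤n)) σ av₁) (max-avoids p231 1F (s≤s (s≤s z≤n)) σ av₂) }
  ; complete = complete
  }
  where
  -- A first letter a that is neither minimal nor maximal starts a 213 or a 231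
  -- whose other two letters are a - 1 and a + 1.
  extreme : ∀ (c : Fin n) {σ : Word (suc n)} → ¬ Avoider p213 p231 (inject₁ (suc c) ◂ σ)
  extreme c {σ} av
    -- Here a is c + 1, so in `σ` the letters a - 1 and a + 1 are standardized to the values c and c
    -- + 1.
    with occurs σ (Avoider.permutation (◂-avoider⁻ av)) (inject₁ c)
       | occurs σ (Avoider.permutation (◂-avoider⁻ av)) (suc c)
  ... | i , σᵢ≡c | j , σⱼ≡c+1 = absurd
    where
    a = inject₁ (suc c)

    c<c+1 : inject₁ c < suc c
    c<c+1 = s≤s (ℕ.≤-reflexive (toℕ-inject₁ c))

    below : punchIn a (lookup σ i) < a
    below = subst (λ x → punchIn a x < a) (sym σᵢ≡c) (<⇒punchIn< a _ ℕ.≤-refl)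

    above : a < punchIn a (lookup σ j)
    above = subst (λ x → a < punchIn a x) (sym σⱼ≡c+1)
      (≤⇒<punchIn a _ (s≤s (ℕ.≤-reflexive (toℕ-inject₁ c))))

    absurd : ⊥
    absurd with <-cmp i j
    ... | tri≈ _ refl _ = <-irrefl (trans (sym σᵢ≡c) σⱼ≡c+1) c<c+1
    ... | tri< i<j _ _  = Avoider.avoids₁ av
      (◂-contains⁺ a σ p213 i<j (sameOrder-sorted below above p213))
    ... | tri> _ _ j<i  = Avoider.avoids₂ av
      (◂-contains⁺ a σ p231 j<i (sameOrder-sorted below above p231))

  complete : ∀ a {σ : Word (suc n)} → Avoider p213 p231 (a ◂ σ) → a ≡ 0F ⊎ a ≡ fromℕ (suc n)
  complete a av with view a
  ... | ‵fromℕ           = inj₂ refl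
  ... | ‵inject₁ zero    = inj₁ refl
  ... | ‵inject₁ (suc c) = contradiction av (extreme c)

-- First letters for {132, 213}

next-or-max : Generates p132 p213 (inject₁ ∘ head) max
next-or-max = record
  { distinct = λ _ → fromℕ≢inject₁ ∘ sym
  ; sound₁   = sound
  ; sound₂   = λ { {σ = σ} (avoider p av₁ av₂) → avoider (◂-permutation⁺ _ σ p)
      (max-avoids p132 1F (s≤s z≤n) σ av₁) (max-avoids p213 2F (s≤s (s≤s z≤n)) σ av₂) }
  ; complete = complete
  }
  where
  -- No value separates the new letter from `s`. In an occurrence starting at the new letter, `s`
  -- can therefore take its place, giving an occurrence in `σ`; if `s` is already the second letter,
  -- the required inequalities contradict each other.
  sound : {σ : Word (suc n)} → Avoider p132 p213 σ → Avoider p132 p213 (inject₁ (head σ) ◂ σ)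
  sound {σ = σ@(s ∷ τ)} (avoider p@(inj , _) av₁ av₂) = avoider (◂-permutation⁺ a σ p)
    (◂-avoids⁺ a σ p132 av₁ avoids-132) (◂-avoids⁺ a σ p213 av₂ avoids-213)
    where
    a = inject₁ s

    larger : ∀ k → a < punchIn a (lookup σ (suc k)) → s < lookup σ (suc k)
    -- `<punchIn⇒≤` yields only a weak inequality; injectivity of `σ` rules out a second copy of
    -- `s`.
    larger k a<↑σₖ = ≤∧≢⇒<
      (ℕ.≤-trans (ℕ.≤-reflexive (sym (toℕ-inject₁ s))) (<punchIn⇒≤ a _ a<↑σₖ))
      λ s≡σₖ → contradiction (inj {zero} {suc k} s≡σₖ) λ ()

    smaller : ∀ j → punchIn a (lookup σ j) < a → lookup σ j < s
    smaller j ↑σⱼ<a = ℕ.<-≤-trans (punchIn<⇒< a _ ↑σⱼ<a) (ℕ.≤-reflexive (toℕ-inject₁ s))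

    avoids-132 : ∀ j k → j < k → ¬ SameOrder (◂-letters a σ j k) p132
    avoids-132 j (suc k) j<k same
      with larger k (from (same 0F 2F) (s≤s z≤n))
         | punchIn-cancel-< a (from (same 2F 1F) (s≤s (s≤s z≤n)))
    avoids-132 zero    (suc k) j<k same | s<σₖ | σₖ<s  = <-asym s<σₖ σₖ<s
    avoids-132 (suc j) (suc k) j<k same | s<σₖ | σₖ<σⱼ =
      av₁ (contains⁺ σ p132 (zero ∷ suc j ∷ suc k ∷ []) (s≤s z≤n ∷ j<k ∷ [-])
        (sameOrder-sorted s<σₖ σₖ<σⱼ p132))

    avoids-213 : ∀ j k → j < k → ¬ SameOrder (◂-letters a σ j k) p213
    avoids-213 j (suc k) j<k same
      with smaller j (from (same 1F 0F) (s≤s z≤n))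
         | larger k (from (same 0F 2F) (s≤s (s≤s z≤n)))
    avoids-213 zero    (suc k) j<k same | s<s  | _    = <-irrefl refl s<s
    avoids-213 (suc j) (suc k) j<k same | σⱼ<s | s<σₖ =
      av₂ (contains⁺ σ p213 (zero ∷ suc j ∷ suc k ∷ []) (s≤s z≤n ∷ j<k ∷ [-])
        (sameOrder-sorted σⱼ<s s<σₖ p213))

  -- A non-maximal first letter a is followed by a + 1 somewhere; unless a + 1 comes
  -- immediately after a, the first two letters and a + 1 form a 132 or a 213.
  next : ∀ (c : Fin (suc n)) {σ : Word (suc n)} → Avoider p132 p213 (inject₁ c ◂ σ) → c ≡ head σ
  -- With a = `inject₁ c`, the letter a + 1 is the value `c` of `σ` after its shift by `punchIn`.
  next c {σ@(s ∷ τ)} av with occurs σ (Avoider.permutation (◂-avoider⁻ av)) c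
  ... | zero  , s≡c  = sym s≡c
  ... | suc i , refl with <-cmp s c
  ...   | tri≈ _ s≡c _ = sym s≡c
  ...   | tri< s<c _ _ = contradiction
    (◂-contains⁺ (inject₁ c) σ p213 {j = zero} {suc i} (s≤s z≤n)
      (sameOrder-sorted
        (<⇒punchIn< (inject₁ c) s (subst (toℕ s ℕ.<_) (sym (toℕ-inject₁ c)) s<c))
        (≤⇒<punchIn (inject₁ c) c (ℕ.≤-reflexive (toℕ-inject₁ c))) p213))
    (Avoider.avoids₂ av)
  ...   | tri> _ _ c<s = contradiction
    (◂-contains⁺ (inject₁ c) σ p132 {j = zero} {suc i} (s≤s z≤n)
      (sameOrder-sorted
        (≤⇒<punchIn (inject₁ c) c (ℕ.≤-reflexive (toℕ-inject₁ c)))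
        (punchIn-mono-< (inject₁ c) c<s) p132))
    (Avoider.avoids₁ av)

  complete : ∀ a {σ : Word (suc n)} → Avoider p132 p213 (a ◂ σ) →
             a ≡ inject₁ (head σ) ⊎ a ≡ fromℕ (suc n)
  complete a av with view a
  ... | ‵fromℕ     = inj₂ refl
  ... | ‵inject₁ c = inj₁ (cong inject₁ (next c av))

proposition10 : ∀ (n k : ℕ) → n ≥ 1 →
    (aᵃˢᶜ n k p132 p213 ≡ aᵈᵉˢ n k p132 p213) ×
    (aᵈᵉˢ n k p132 p213 ≡ aᵃˢᶜ n k p213 p231) ×
    (aᵃˢᶜ n k p213 p231 ≡ aᵈᵉˢ n k p213 p231) ×
    (aᵈᵉˢ n k p213 p231 ≡ (n ∸ 1) C k)
proposition10 (suc n) k _ =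
  trans (Next.aᵃˢᶜ≡C n k) (sym (Next.aᵈᵉˢ≡C n k)) ,
  trans (Next.aᵈᵉˢ≡C n k) (sym (Zero.aᵃˢᶜ≡C n k)) ,
  trans (Zero.aᵃˢᶜ≡C n k) (sym (Zero.aᵈᵉˢ≡C n k)) ,
  Zero.aᵈᵉˢ≡C n k
  where
  module Next = Statistics (λ σ → ℕ.≤-reflexive (toℕ-inject₁ (head σ))) next-or-max
  module Zero = Statistics (λ _ → z≤n) zero-or-max
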